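{- Let $\mathcal S=(n,I,J,K,\psi,\pi)$ be a system and let $(y_i)_{i=0}^n$ be the sequence generated by $\mathcal S$. Then $y_n\le F(n+1)$.
   Context: The Fibonacci numbers are defined by $F(0)=F(1)=1$, $F(m+1)=F(m)+F(m-1)$. A system is a tuple $\mathcal S=(n,I,J,K,\psi,\pi)$ where $n\ge2$ is an integer, $I,J,K$ are pairwise disjoint subsets of $\{2,\dots,n\}$ with $|I|=|J|\ge|K|$, $\psi:I\to J$ is a bijection, $\pi:I\to K$ is a surjection, and $i<\pi(i)<\psi(i)$ for all $i\in I$. Indices in $I$, $J$, $K$ are called exceptional, penalty and fine respectively; indices in $\{2,\dots,n\}$ in none of them are ordinary. For $k\in K$ put $d(k)=\min\pi^{ -1}(k)$. For $2\le r\le n$ let $\theta(r)=r-2$ if $r$ is ordinary, $r-1$ if $r$ is exceptional, $\psi^{ -1}(r)-1$ if $r$ is penalty, and $d(r)-2$ if $r$ is fine. The sequence generated by $\mathcal S$ is the sequence $(y_i)_{i=0}^n$ with $y_0=1$, $y_1=2$ and $y_r=y_{r-1}+y_{\theta(r)}$ for $2\le r\le n$. -}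

module Defs where

open import Data.Nat using (ℕ; zero; suc; _+_; _∸_; _≤_; _<_; _≥_; _≡ᵇ_)
open import Data.Bool using (Bool; true; false; if_then_else_; _∧_)
open import Data.Maybe using (Maybe; just; nothing; fromMaybe)
open import Data.Product using (_×_; Σ; ∃)
open import Relation.Binary.PropositionalEquality using (_≡_)

F : ℕ → ℕ
F zero = 1
F (suc zero) = 1
F (suc (suc m)) = F (suc m) + F m

least : (ℕ → Bool) → ℕ → Maybe ℕ
least p zero = nothing
least p (suc m) with least p m
... | just i = just i
... | nothing = if p m then just m else nothing

count : (ℕ → Bool) → ℕ → ℕ
count p zero = if p zero then 1 else 0
count p (suc m) = count p m + (if p (suc m) then 1 else 0)

-- A system (n, I, J, K, ψ, π).  Subsets of {2,…,n} are given by their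
-- (Boolean) characteristic functions on ℕ; ψ and π are functions on ℕ
-- whose values matter only on I.
record System : Set where
  field
    n   : ℕ
    n≥2 : n ≥ 2
    I J K : ℕ → Bool
    ψ π : ℕ → ℕ
    I⊆ : ∀ i → I i ≡ true → 2 ≤ i × i ≤ n
    J⊆ : ∀ i → J i ≡ true → 2 ≤ i × i ≤ n
    K⊆ : ∀ i → K i ≡ true → 2 ≤ i × i ≤ n
    IJ-disj : ∀ i → I i ≡ true → J i ≡ false
    IK-disj : ∀ i → I i ≡ true → K i ≡ false
    JK-disj : ∀ i → J i ≡ true → K i ≡ false
    |I|≡|J| : count I n ≡ count J n
    |J|≥|K| : count J n ≥ count K n
    ψ-maps : ∀ i → I i ≡ true → J (ψ i) ≡ true
    ψ-inj  : ∀ i i′ → I i ≡ true → I i′ ≡ true → ψ i ≡ ψ i′ → i ≡ i′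
    ψ-surj : ∀ j → J j ≡ true → ∃ λ i → I i ≡ true × ψ i ≡ j
    π-maps : ∀ i → I i ≡ true → K (π i) ≡ true
    π-surj : ∀ k → K k ≡ true → ∃ λ i → I i ≡ true × π i ≡ k
    π-ord : ∀ i → I i ≡ true → i < π i
    ψ-ord : ∀ i → I i ≡ true → π i < ψ i

module _ (S : System) where
  open System S

  ψinv : ℕ → ℕ
  ψinv r = fromMaybe 0 (least (λ i → I i ∧ (ψ i ≡ᵇ r)) (suc n))

  d : ℕ → ℕ
  d k = fromMaybe 0 (least (λ i → I i ∧ (π i ≡ᵇ k)) (suc n))

  θ : ℕ → ℕ
  θ r = if I r then r ∸ 1 else
        (if J r then ψinv r ∸ 1 else
        (if K r then d r ∸ 2 else r ∸ 2))

  Generated : (ℕ → ℕ) → Set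
  Generated y = (y 0 ≡ 1) × (y 1 ≡ 2) ×
    (∀ r → 2 ≤ r → r ≤ n → y r ≡ y (r ∸ 1) + y (θ r))

{-# OPTIONS --safe #-}
-- The sequence is compared with a model in which pending doublings can be undone. Reading the indices
-- from left to right, keep a word of ordinary steps, doublings and blocks "doubling at k - 1, then fine k",
-- whose last two values satisfy y_r ≤ E₁ and y_r + y_{r-1} ≤ E₁ + E₀ even after the penalties y_{i-1} still
-- owed for fines already met are added on the left and those of the fibres in blocks on the right. A fine k with k - 1 not in its fibre becomes an ordinary step, since what it
-- adds together with all penalties of its fibre is at most y_{k-2}. At a penalty the last block, or if there
-- is none the last doubling, is replaced by ordinary steps; this loses nothing, because the penalty step also
-- becomes ordinary. Every doubling is eventually undone this way, and the word of n - 1 ordinary steps is F.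

module Submission where

open import Defs
open import Data.Nat using (ℕ; zero; suc; _+_; _*_; _∸_; _⊓_; _≤_; _<_; _≡ᵇ_; z≤n; s≤s; _≤?_; _≟_)
open import Data.Nat.Properties
open import Data.Nat.Tactic.RingSolver using (solve)
open import Data.Bool using (Bool; true; false; if_then_else_; _∧_)
open import Data.Bool.Properties using (T-≡; ¬-not)
open import Data.List using (List; []; _∷_; replicate)
open import Data.Maybe using (just; nothing; fromMaybe)
open import Data.Product using (_×_; _,_; proj₁; proj₂; Σ-syntax; ∃-syntax)
open import Data.Sum using (_⊎_; inj₁; inj₂)
open import Data.Unit using (⊤; tt)
open import Data.Empty using (⊥-elim)
open import Function using (id)
open import Function.Bundles using (Equivalence)
open import Relation.Nullary using (yes; no)
open import Relation.Binary.PropositionalEquality using (_≡_; _≢_; refl; sym; trans; cong; cong₂; subst; subst₂; ≢-sym)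

-- Certificate for a linear inequality: a ≤ b follows from x ≤ y with multiplier k + 1 and slack s.
cert : ∀ {a b x y} k s → x ≤ y → suc k * a + y + s ≡ suc k * b + x → a ≤ b
cert {a} {b} {x} {y} k s p e =
  *-cancelˡ-≤ (suc k)
    (+-cancelʳ-≤ y (suc k * a) (suc k * b)
      (≤-trans (m≤m+n _ s) (≤-trans (≤-reflexive e) (+-monoʳ-≤ (suc k * b) p))))

infixr 6 _⊕_
_⊕_ : ∀ {a b c d} → a ≤ b → c ≤ d → a + c ≤ b + d
_⊕_ = +-mono-≤

-- Finite sums over intervals of indices.

sumFrom : (ℕ → ℕ) → ℕ → ℕ → ℕ
sumFrom f c zero    = 0
sumFrom f c (suc l) = f c + sumFrom f (suc c) l

sumFrom-+ : ∀ f g c l → sumFrom (λ i → f i + g i) c l ≡ sumFrom f c l + sumFrom g c l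
sumFrom-+ f g c zero    = refl
sumFrom-+ f g c (suc l) rewrite sumFrom-+ f g (suc c) l =
  shuffle (f c) (g c) (sumFrom f (suc c) l) (sumFrom g (suc c) l)
  where
  shuffle : ∀ a b p q → a + b + (p + q) ≡ a + p + (b + q)
  shuffle a b p q = solve (a ∷ b ∷ p ∷ q ∷ [])

sumFrom-cong : ∀ {f g} c l → (∀ i → f i ≡ g i) → sumFrom f c l ≡ sumFrom g c l
sumFrom-cong c zero    e = refl
sumFrom-cong c (suc l) e = cong₂ _+_ (e c) (sumFrom-cong (suc c) l e)

sumFrom-mono : ∀ {f g} c l → (∀ i → f i ≤ g i) → sumFrom f c l ≤ sumFrom g c l
sumFrom-mono c zero    e = z≤n
sumFrom-mono c (suc l) e = e c ⊕ sumFrom-mono (suc c) l e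

sumFrom-0 : ∀ {f} c l → (∀ i → c ≤ i → f i ≡ 0) → sumFrom f c l ≡ 0
sumFrom-0 c zero    e = refl
sumFrom-0 c (suc l) e =
  cong₂ _+_ (e c ≤-refl) (sumFrom-0 (suc c) l (λ i c<i → e i (<⇒≤ c<i)))

sumFrom-single-≤ : ∀ {f} i₀ c l → (∀ i → i ≢ i₀ → f i ≡ 0) → sumFrom f c l ≤ f i₀
sumFrom-single-≤ i₀ c zero e = z≤n
sumFrom-single-≤ {f} i₀ c (suc l) e with c ≟ i₀
... | yes refl =
  ≤-reflexive (trans (cong (f c +_) (sumFrom-0 (suc c) l (λ i c<i → e i (>⇒≢ c<i)))) (+-identityʳ _))
... | no c≢i₀ rewrite e c c≢i₀ = sumFrom-single-≤ i₀ (suc c) l e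

term≤sumFrom : ∀ f i₀ c l → c ≤ i₀ → i₀ < c + l → f i₀ ≤ sumFrom f c l
term≤sumFrom f i₀ c zero    c≤i₀ i₀<c = ⊥-elim (<⇒≱ i₀<c (≤-trans (≤-reflexive (+-identityʳ c)) c≤i₀))
term≤sumFrom f i₀ c (suc l) c≤i₀ i₀<c with c ≟ i₀
... | yes refl = m≤m+n _ _
... | no c≢i₀  =
  ≤-trans (term≤sumFrom f i₀ (suc c) l (≤∧≢⇒< c≤i₀ c≢i₀) (subst (i₀ <_) (+-suc c l) i₀<c)) (m≤n+m _ _)

sumFrom-single : ∀ {f} i₀ c l → c ≤ i₀ → i₀ < c + l → (∀ i → i ≢ i₀ → f i ≡ 0) → sumFrom f c l ≡ f i₀
sumFrom-single {f} i₀ c l p q e = ≤-antisym (sumFrom-single-≤ i₀ c l e) (term≤sumFrom f i₀ c l p q)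

times : ∀ k {a b} → a ≤ b → k * a ≤ k * b
times k = *-monoʳ-≤ k

-- Abel summation against a monotone weight.

module Abel {f g h : ℕ → ℕ} (N : ℕ)
  (h-mono : ∀ i → h i ≤ h (suc i))
  (tails : ∀ c l → c + l ≡ N → sumFrom f c l ≤ sumFrom g c l) where

  fh gh : ℕ → ℕ
  fh i = f i * h i
  gh i = g i * h i

  -- Subtraction-free form of Σ (g i - f i)(h i - h c) ≥ 0 over the tail from `c`. Lowering the base
  -- from `h (suc c)` to `h c` adds their difference times the excess of the tail of `g` over that
  -- of `f`.
  weighted-tail : ∀ c l → c + l ≡ N →
    sumFrom fh c l + h c * sumFrom g c l ≤ sumFrom gh c l + h c * sumFrom f c l
  weighted-tail c zero    e = ≤-refl
  weighted-tail c (suc l) e =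
    go (f c) (g c) (sumFrom f (suc c) l) (sumFrom g (suc c) l)
       (sumFrom fh (suc c) l) (sumFrom gh (suc c) l) (h c) (h (suc c)) (h-mono c)
       (tails (suc c) l e′) (weighted-tail (suc c) l e′)
    where
    e′ : suc c + l ≡ N
    e′ = trans (sym (+-suc c l)) e
    go : ∀ a b tf tg sf sg k k′ → k ≤ k′ → tf ≤ tg → sf + k′ * tg ≤ sg + k′ * tf →
      a * k + sf + k * (b + tg) ≤ b * k + sg + k * (a + tf)
    go a b tf tg sf sg k k′ k≤k′ t ih with m≤n⇒∃[o]m+o≡n k≤k′
    ... | x , refl = cert 0 0 (ih ⊕ xt)
      (solve (a ∷ b ∷ tf ∷ tg ∷ sf ∷ sg ∷ k ∷ x ∷ []))
      where
      xt : x * tf ≤ x * tg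
      xt = *-monoʳ-≤ x t

  weighted-≤ : sumFrom fh 0 N ≤ sumFrom gh 0 N
  weighted-≤ = +-cancelʳ-≤ (h 0 * sumFrom g 0 N) _ _
    (≤-trans (weighted-tail 0 N refl) (+-monoʳ-≤ _ (*-monoʳ-≤ (h 0) (tails 0 N refl))))

-- Indicators of fibres and their running sums.

≡⇒≡ᵇ-true : ∀ {m n} → m ≡ n → (m ≡ᵇ n) ≡ true
≡⇒≡ᵇ-true {m} {n} e = Equivalence.to T-≡ (≡⇒≡ᵇ m n e)

≡ᵇ-true⇒≡ : ∀ {m n} → (m ≡ᵇ n) ≡ true → m ≡ n
≡ᵇ-true⇒≡ {m} {n} e = ≡ᵇ⇒≡ m n (Equivalence.from T-≡ e)

≢⇒≡ᵇ-false : ∀ {m n} → m ≢ n → (m ≡ᵇ n) ≡ false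
≢⇒≡ᵇ-false m≢n = ¬-not (λ e → m≢n (≡ᵇ-true⇒≡ e))

opaque
  hit : (ℕ → Bool) → (ℕ → ℕ) → ℕ → ℕ → ℕ
  hit I ρ r i = if I i ∧ (ρ i ≡ᵇ r) then 1 else 0

  hit-yes : ∀ {I ρ r i} → I i ≡ true → ρ i ≡ r → hit I ρ r i ≡ 1
  hit-yes Ii e rewrite Ii | ≡⇒≡ᵇ-true e = refl

  hit-no : ∀ {I ρ r i} → (I i ≡ true → ρ i ≢ r) → hit I ρ r i ≡ 0
  hit-no {I} {i = i} ne with I i
  ... | false = refl
  ... | true rewrite ≢⇒≡ᵇ-false (ne refl) = refl

  hit-cases : ∀ I ρ r i → hit I ρ r i ≡ 0 ⊎ (hit I ρ r i ≡ 1 × I i ≡ true × ρ i ≡ r)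
  hit-cases I ρ r i with I i in Ii | ρ i ≡ᵇ r in e
  ... | false | _     = inj₁ refl
  ... | true  | false = inj₁ refl
  ... | true  | true  = inj₂ (refl , refl , ≡ᵇ-true⇒≡ e)

-- Indicator of `i` in `I` with `ρ i ≤ r`, built from hits so that advancing `r` by one adds exactly
-- one fibre. With `ψ`, `π` or `id` for `ρ` it records the penalties paid, the fines met and the
-- exceptional indices met.
cum : (ℕ → Bool) → (ℕ → ℕ) → ℕ → ℕ → ℕ
cum I ρ zero    i = hit I ρ zero i
cum I ρ (suc r) i = cum I ρ r i + hit I ρ (suc r) i

module _ {I : ℕ → Bool} {ρ : ℕ → ℕ} where

  cum-early : ∀ r i → (I i ≡ true → r < ρ i) → cum I ρ r i ≡ 0
  cum-early zero    i lt = hit-no (λ Ii → >⇒≢ (lt Ii))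
  cum-early (suc r) i lt
    rewrite cum-early r i (λ Ii → <-trans (n<1+n r) (lt Ii)) = hit-no (λ Ii → >⇒≢ (lt Ii))

  cum-late : ∀ r i → I i ≡ true → ρ i ≤ r → cum I ρ r i ≡ 1
  cum-late zero    i Ii le = hit-yes Ii (n≤0⇒n≡0 le)
  cum-late (suc r) i Ii le with ρ i ≟ suc r
  ... | yes e rewrite cum-early r i (λ _ → ≤-reflexive (sym e)) = hit-yes Ii e
  ... | no ne rewrite cum-late r i Ii (≤-pred (≤∧≢⇒< le ne)) = cong suc (hit-no (λ _ → ne))

cum-antitone : ∀ {I} {ρ ρ′ : ℕ → ℕ} r i → (I i ≡ true → ρ i ≤ ρ′ i) → cum I ρ′ r i ≤ cum I ρ r i
cum-antitone {I} {ρ} {ρ′} r i le with I i in Ii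
... | false = ≤-trans (≤-reflexive (cum-early r i (λ t → ⊥-elim (true≢false (trans (sym t) Ii))))) z≤n
  where
  true≢false : true ≢ false
  true≢false ()
... | true with ρ′ i ≤? r
...   | yes p = ≤-reflexive (trans (cum-late r i Ii p) (sym (cum-late r i Ii (≤-trans (le refl) p))))
...   | no ¬p = ≤-trans (≤-reflexive (cum-early r i (λ _ → ≰⇒> ¬p))) z≤n

-- The recursion, freed from the encoding of systems.

data Step (I : ℕ → Bool) (ψ π y : ℕ → ℕ) (r : ℕ) : Set where
  ordinary : y r ≡ y (r ∸ 1) + y (r ∸ 2) → I r ≡ false →
    (∀ i → I i ≡ true → ψ i ≢ r) → (∀ i → I i ≡ true → π i ≢ r) → Step I ψ π y r
  exceptional : I r ≡ true →
    (∀ i → I i ≡ true → ψ i ≢ r) → (∀ i → I i ≡ true → π i ≢ r) → Step I ψ π y r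
  penalty : ∀ j → I j ≡ true → ψ j ≡ r → y r ≡ y (r ∸ 1) + y (j ∸ 1) →
    I r ≡ false → (∀ i → I i ≡ true → π i ≢ r) → Step I ψ π y r
  fine : ∀ d → I d ≡ true → π d ≡ r → (∀ i → I i ≡ true → π i ≡ r → d ≤ i) →
    y r ≡ y (r ∸ 1) + y (d ∸ 2) →
    I r ≡ false → (∀ i → I i ≡ true → ψ i ≢ r) → Step I ψ π y r

record Dynamics (n : ℕ) (I : ℕ → Bool) (ψ π y : ℕ → ℕ) : Set where
  field
    y0     : y 0 ≡ 1
    y1     : y 1 ≡ 2
    y-mono : ∀ r → y r ≤ y (suc r)
    I≥2    : ∀ {i} → I i ≡ true → 2 ≤ i
    I≤n    : ∀ {i} → I i ≡ true → i ≤ n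
    i<π    : ∀ {i} → I i ≡ true → i < π i
    π<ψ    : ∀ {i} → I i ≡ true → π i < ψ i
    ψ≤n    : ∀ {i} → I i ≡ true → ψ i ≤ n
    ψ-inj  : ∀ {i j} → I i ≡ true → I j ≡ true → ψ i ≡ ψ j → i ≡ j
    double : ∀ {i} → I (suc i) ≡ true → y (suc i) ≡ y i + y i
    step   : ∀ r → suc (suc r) ≤ n → Step I ψ π y (suc (suc r))

-- Penalty weights and the bound on the penalties of one fibre.

module Simulation {n I ψ π y} (D : Dynamics n I ψ π y) where
  open Dynamics D

  N : ℕ
  N = suc n

  h : ℕ → ℕ
  h i = y (i ∸ 1)

  h-mono : ∀ i → h i ≤ h (suc i)
  h-mono zero    = ≤-refl
  h-mono (suc i) = y-mono i

  y-mono-≤ : ∀ {r s} → r ≤ s → y r ≤ y s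
  y-mono-≤ {r} {s} r≤s with m≤n⇒∃[o]m+o≡n r≤s
  ... | o , refl = go o
    where
    go : ∀ o → y r ≤ y (r + o)
    go zero    = ≤-reflexive (cong y (sym (+-identityʳ r)))
    go (suc o) = ≤-trans (go o) (≤-trans (y-mono (r + o)) (≤-reflexive (cong y (sym (+-suc r o)))))

  total weight : (ℕ → ℕ) → ℕ
  total f  = sumFrom f 0 N
  weight f = sumFrom (λ i → f i * h i) 0 N

  weight-cong : ∀ {f g} → (∀ i → f i ≡ g i) → weight f ≡ weight g
  weight-cong e = sumFrom-cong 0 N (λ i → cong (_* h i) (e i))

  weight-+ : ∀ f g → weight (λ i → f i + g i) ≡ weight f + weight g
  weight-+ f g = trans (sumFrom-cong 0 N (λ i → *-distribʳ-+ (h i) (f i) (g i)))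
    (sumFrom-+ (λ i → f i * h i) (λ i → g i * h i) 0 N)

  weight-0 : ∀ {f} → (∀ i → f i ≡ 0) → weight f ≡ 0
  weight-0 e = sumFrom-0 0 N (λ i _ → cong (_* h i) (e i))

  module _ {j} (Ij : I j ≡ true) where

    weight-hitψ : weight (hit I ψ (ψ j)) ≡ h j
    weight-hitψ = trans
      (sumFrom-single j 0 N z≤n (s≤s (I≤n Ij))
        (λ i ne → cong (_* h i) (hit-no (λ Ii e → ne (ψ-inj Ii Ij e)))))
      (trans (cong (_* h j) (hit-yes Ij refl)) (+-identityʳ _))

    total-hitψ : total (hit I ψ (ψ j)) ≡ 1
    total-hitψ = trans
      (sumFrom-single j 0 N z≤n (s≤s (I≤n Ij)) (λ i ne → hit-no (λ Ii e → ne (ψ-inj Ii Ij e))))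
      (hit-yes Ij refl)

    tail-hitψ : ∀ c l → sumFrom (hit I ψ (ψ j)) c l ≤ 1
    tail-hitψ c l = ≤-trans
      (sumFrom-single-≤ j c l (λ i ne → hit-no (λ Ii e → ne (ψ-inj Ii Ij e))))
      (≤-reflexive (hit-yes Ij refl))

    total-hitid : total (hit I id j) ≡ 1
    total-hitid = trans
      (sumFrom-single j 0 N z≤n (s≤s (I≤n Ij)) (λ i ne → hit-no (λ _ e → ne e)))
      (hit-yes Ij refl)

  fibre : ℕ → ℕ
  fibre k = weight (hit I π k)

  -- Doubling at an exceptional i means y (i ∸ 1) = y i ∸ y (i ∸ 1), so the sum telescopes.
  fibre-telescope : ∀ k m → (∀ i → m < i → hit I π k i ≡ 0) → ∀ c l → c ≤ m →
    sumFrom (λ i → hit I π k i * h i) (suc c) l + y c ≤ y m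
  fibre-telescope k m hi c zero    c≤m = y-mono-≤ c≤m
  fibre-telescope k m hi c (suc l) c≤m with suc c ≤? m
  ... | no ¬p =
    ≤-trans (≤-reflexive (cong (_+ y c)
      (sumFrom-0 (suc c) (suc l) (λ i q → cong (_* h i) (hi i (<-≤-trans (≰⇒> ¬p) q))))))
      (y-mono-≤ c≤m)
  ... | yes p with hit-cases I π k (suc c)
  ...   | inj₁ e rewrite e =
    ≤-trans (+-monoʳ-≤ _ (y-mono c)) (fibre-telescope k m hi (suc c) l p)
  ...   | inj₂ (e , Ic , _) rewrite e =
    ≤-trans (≤-reflexive (regroup (y c) _ (double Ic))) (fibre-telescope k m hi (suc c) l p)
    where
    regroup : ∀ a s → y (suc c) ≡ a + a → a + 0 + s + a ≡ s + y (suc c)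
    regroup a s e rewrite e = solve (a ∷ s ∷ [])

  -- Skipping the zero terms up to `d` leaves the telescoping sum that starts at `y d`, and nothing
  -- above `m` contributes. Callers pass the predecessor of the least element of the fibre as `d`.
  fibre-bound : ∀ k m d → d ≤ m →
    (∀ i → i ≤ d → hit I π k i ≡ 0) → (∀ i → m < i → hit I π k i ≡ 0) → fibre k + y d ≤ y m
  fibre-bound k m d d≤m lo hi = go 0 N z≤n
    where
    go : ∀ c l → c ≤ suc d → sumFrom (λ i → hit I π k i * h i) c l + y d ≤ y m
    go c zero    c≤ = y-mono-≤ d≤m
    go c (suc l) c≤ with c ≟ suc d
    ... | yes refl = fibre-telescope k m hi d (suc l) d≤m
    ... | no c≢ rewrite lo c (≤-pred (≤∧≢⇒< c≤ c≢)) = go (suc c) l (≤∧≢⇒< c≤ c≢)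

  -- Words of ordinary steps, doublings and blocks.

  -- A block stores the amount v added at the fine index and the index m of the doubling before it.
  data Stack : Set where
    nil : Stack
    ord dbl : Stack → Stack
    blk : (v m : ℕ) → Stack → Stack

  E₁ E₀ len open# : Stack → ℕ
  E₁ nil         = 2
  E₁ (ord W)       = E₁ W + E₀ W
  E₁ (dbl W)       = E₁ W + E₁ W
  E₁ (blk v m W) = E₁ W + E₁ W + v
  E₀ nil         = 1
  E₀ (ord W)       = E₁ W
  E₀ (dbl W)       = E₁ W
  E₀ (blk v m W) = E₁ W + E₁ W
  len nil         = 0
  len (ord W)       = suc (len W)
  len (dbl W)       = suc (len W)
  len (blk v m W) = suc (suc (len W))
  open# nil         = 0
  open# (ord W)       = open# W
  open# (dbl W)       = suc (open# W)
  open# (blk v m W) = suc (open# W)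

  -- Marks the exceptional indices whose penalties are credited to blocks; the fine of a block sits
  -- at `suc m`.
  β : Stack → ℕ → ℕ
  β nil         i = 0
  β (ord W)       i = β W i
  β (dbl W)       i = β W i
  β (blk v m W) i = hit I π (suc m) i + β W i

  Below : ℕ → Stack → Set
  Below b nil         = ⊤
  Below b (ord W)       = Below b W
  Below b (dbl W)       = Below b W
  Below b (blk v m W) = m < b × Below b W

  WF : Stack → Set
  WF nil         = ⊤
  WF (ord W)       = WF W
  WF (dbl W)       = WF W
  -- The bounds on `v` are what undoing the block consumes. By `π m ≡ suc m` the index `m` lies in
  -- the fibre of its own block, and `Below m W` puts it beyond the fibres of all earlier blocks.
  WF (blk v m W) = (v ≤ E₀ W × v + fibre (suc m) ≤ E₁ W + E₁ W) ×
                   (I m ≡ true × π m ≡ suc m) × Below m W × WF W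

  Below-mono : ∀ {b b′} → b ≤ b′ → ∀ W → Below b W → Below b′ W
  Below-mono le nil         p = tt
  Below-mono le (ord W)       p = Below-mono le W p
  Below-mono le (dbl W)       p = Below-mono le W p
  Below-mono le (blk v m W) (p , q) = <-≤-trans p le , Below-mono le W q

  -- The fibre of a block with doubling at `m` ends at `m`, because `i < π i = suc m` for its
  -- members.
  β-above : ∀ {b} W → Below b W → ∀ i → b ≤ i → β W i ≡ 0
  β-above nil         p i b≤i = refl
  β-above (ord W)       p i b≤i = β-above W p i b≤i
  β-above (dbl W)       p i b≤i = β-above W p i b≤i
  β-above (blk v m W) (p , q) i b≤i
    rewrite β-above W q i b≤i | +-identityʳ (hit I π (suc m) i) =
    hit-no (λ Ii e → <⇒≱ (<-≤-trans p b≤i) (≤-pred (subst (i <_) e (i<π Ii))))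

  E-bounds : ∀ W → WF W → E₀ W ≤ E₁ W × E₁ W ≤ E₀ W + E₀ W
  E-bounds nil   wf = s≤s z≤n , ≤-refl
  E-bounds (ord W) wf with E-bounds W wf
  ... | p , q = m≤m+n _ _ , +-monoʳ-≤ (E₁ W) p
  E-bounds (dbl W) wf = m≤m+n _ _ , ≤-refl
  E-bounds (blk v m W) ((v≤ , _) , _ , _ , wf) with E-bounds W wf
  ... | p , q = m≤m+n _ _ , +-monoʳ-≤ (E₁ W + E₁ W) (≤-trans v≤ (≤-trans p (m≤m+n _ _)))

  data Letter : Set where
    ord dbl : Letter

  app : List Letter → Stack → Stack
  app []      W = W
  app (ord ∷ L) W = ord (app L W)
  app (dbl ∷ L) W = dbl (app L W)

  len-app : ∀ L {V W} → len V ≡ len W → len (app L V) ≡ len (app L W)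
  len-app []      e = e
  len-app (ord ∷ L) e = cong suc (len-app L e)
  len-app (dbl ∷ L) e = cong suc (len-app L e)

  open#-app : ∀ L {V W} → open# V ≡ suc (open# W) → open# (app L V) ≡ suc (open# (app L W))
  open#-app []      e = e
  open#-app (ord ∷ L) e = open#-app L e
  open#-app (dbl ∷ L) e = cong suc (open#-app L e)

  β-app : ∀ L W → β (app L W) ≡ β W
  β-app []      W = refl
  β-app (ord ∷ L) W = β-app L W
  β-app (dbl ∷ L) W = β-app L W

  WF-app : ∀ L {V W} → (WF V → WF W) → WF (app L V) → WF (app L W)
  WF-app []      f = f
  WF-app (ord ∷ L) f = WF-app L f
  WF-app (dbl ∷ L) f = WF-app L f

  WF-base : ∀ L {W} → WF (app L W) → WF W
  WF-base []      wf = wf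
  WF-base (ord ∷ L) wf = WF-base L wf
  WF-base (dbl ∷ L) wf = WF-base L wf

  Below-app : ∀ L {b V W} → (Below b V → Below b W) → Below b (app L V) → Below b (app L W)
  Below-app []      f = f
  Below-app (ord ∷ L) f = Below-app L f
  Below-app (dbl ∷ L) f = Below-app L f

  last-block : ∀ W → (∀ i → β W i ≡ 0) ⊎
    (∃[ L ] ∃[ v ] ∃[ m ] Σ[ V ∈ Stack ] W ≡ app L (blk v m V))
  last-block nil = inj₁ (λ _ → refl)
  last-block (ord W) with last-block W
  ... | inj₁ z = inj₁ z
  ... | inj₂ (L , v , m , V , refl) = inj₂ (ord ∷ L , v , m , V , refl)
  last-block (dbl W) with last-block W
  ... | inj₁ z = inj₁ z
  ... | inj₂ (L , v , m , V , refl) = inj₂ (dbl ∷ L , v , m , V , refl)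
  last-block (blk v m W) = inj₂ ([] , v , m , W , refl)

  -- Vanishing of `β` excludes blocks, since the doubling index of a block lies in its own fibre; so
  -- only ordinary steps follow the last doubling.
  last-double : ∀ W → WF W → (∀ i → β W i ≡ 0) → 1 ≤ open# W →
    ∃[ t ] Σ[ V ∈ Stack ] W ≡ app (replicate t ord) (dbl V)
  last-double (ord W) wf z p with last-double W wf z p
  ... | t , V , refl = suc t , V , refl
  last-double (dbl W) wf z p = 0 , W , refl
  last-double (blk v m W) (_ , (Im , πm) , _) z p
    with trans (sym (cong (_+ β W m) (hit-yes Im πm))) (z m)
  ... | ()

  -- Undoing a doubling.

  record Popped (W : Stack) : Set where
    field
      W′     : Stack
      len′   : len W′ ≡ suc (len W)
      wf′    : WF W′
      open′  : open# W ≡ suc (open# W′)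
      below′ : ∀ {b} → Below b W → Below b W′
      γ      : ℕ → ℕ
      split  : ∀ i → β W i ≡ γ i + β W′ i
      -- Undoing a block forfeits the credit `weight γ` for its fibre, so the new word has to absorb
      -- it.
      gain₁  : E₁ W + weight γ ≤ E₁ W′
      -- Two copies of `E₁ W`, because at a penalty `k` the sum of `y k` and `y (k - 1)` is twice
      -- `y (k - 1)` plus the amount paid.
      gain₂  : E₁ W + E₁ W + weight γ ≤ E₁ W′ + E₀ W′
      -- A penalty raises the count of paid indices in a tail by at most one. A lost member of `γ`
      -- makes up for this, unless no remaining block fibre meets the tail.
      tail   : ∀ c l → c + l ≡ N → sumFrom (β W′) c l ≡ 0 ⊎ 1 ≤ sumFrom γ c l

  module PopDouble (V : Stack) (wf : WF V) where

    A A′ : ℕ → Stack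
    A  t = app (replicate t ord) (dbl V)
    A′ t = app (replicate t ord) (ord V)

    -- Two consecutive values of `t` are carried together: past the changed letter both words obey
    -- the Fibonacci rule, so adding the two inequalities gives the next one.
    gains : ∀ t → E₁ (A t) + E₁ (A t) ≤ E₁ (A′ t) + E₁ (A′ t) + E₀ (A′ t) ×
      (E₁ (A t) + E₀ (A t)) + (E₁ (A t) + E₀ (A t)) ≤
      (E₁ (A′ t) + E₀ (A′ t)) + (E₁ (A′ t) + E₀ (A′ t)) + E₁ (A′ t)
    gains zero = base (E₁ V) (E₀ V) (proj₂ (E-bounds V wf))
      where
      base : ∀ x z → x ≤ z + z →
        x + x + (x + x) ≤ x + z + (x + z) + x ×
        (x + x + x) + (x + x + x) ≤ (x + z + x) + (x + z + x) + (x + z)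
      base x z p = cert 0 0 p (solve (x ∷ z ∷ [])) , cert 0 z p (solve (x ∷ z ∷ []))
    gains (suc t) with gains t
    ... | p , q = q , next (E₁ (A t)) (E₀ (A t)) (E₁ (A′ t)) (E₀ (A′ t)) p q
      where
      next : ∀ a b a′ b′ → a + a ≤ a′ + a′ + b′ → (a + b) + (a + b) ≤ (a′ + b′) + (a′ + b′) + a′ →
        (a + b + a) + (a + b + a) ≤ (a′ + b′ + a′) + (a′ + b′ + a′) + (a′ + b′)
      next a b a′ b′ p q = cert 0 0 (p ⊕ q) (solve (a ∷ b ∷ a′ ∷ b′ ∷ []))

    half : ∀ a p q → a + a ≤ p + p + q → a ≤ p + q
    half a p q e = cert 1 q e (solve (a ∷ p ∷ q ∷ []))

    popped : ∀ t → (∀ i → β (A t) i ≡ 0) → Popped (A t)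
    popped t z = record
      { W′     = ord (A′ t)
      ; len′   = cong suc (len-app (replicate t ord) refl)
      ; wf′    = WF-app (replicate t ord) {dbl V} {ord V} id (WF-app (replicate t ord) {V} {dbl V} id (wfV t))
      ; open′  = open#-app (replicate t ord) refl
      ; below′ = Below-app (replicate t ord) {V = dbl V} {W = ord V} id
      ; γ      = λ _ → 0
      ; split  = λ i → cong (λ f → f i) same-β
      ; gain₁  = subst (_≤ E₁ (ord (A′ t))) (sym (weightless (E₁ (A t)))) (half (E₁ (A t)) (E₁ (A′ t)) (E₀ (A′ t)) (proj₁ (gains t)))
      ; gain₂  = subst (_≤ E₁ (ord (A′ t)) + E₀ (ord (A′ t))) (sym (weightless _))
                   (≤-trans (proj₁ (gains t)) (≤-reflexive (swap (E₁ (A′ t)) (E₀ (A′ t)))))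
      ; tail   = λ c l _ → inj₁ (sumFrom-0 c l (λ i _ → trans (sym (cong (λ f → f i) same-β)) (z i)))
      }
      where
      wfV : ∀ t → WF (app (replicate t ord) V)
      wfV zero    = wf
      wfV (suc t) = wfV t
      same-β : β (A t) ≡ β (ord (A′ t))
      same-β = trans (β-app (replicate t ord) (dbl V)) (sym (β-app (replicate t ord) (ord V)))
      weightless : ∀ a → a + weight (λ _ → 0) ≡ a
      weightless a = trans (cong (a +_) (weight-0 (λ _ → refl))) (+-identityʳ a)
      swap : ∀ p q → p + p + q ≡ p + q + p
      swap p q = solve (p ∷ q ∷ [])

  module PopBlock (v m : ℕ) (V : Stack) (wf : WF (blk v m V)) where

    x z c : ℕ
    x = E₁ V
    z = E₀ V
    c = fibre (suc m)

    x≤2z : x ≤ z + z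
    x≤2z = proj₂ (E-bounds V (proj₂ (proj₂ (proj₂ wf))))

    v≤z : v ≤ z
    v≤z = proj₁ (proj₁ wf)

    v+c≤2x : v + c ≤ x + x
    v+c≤2x = proj₂ (proj₁ wf)

    A A′ : List Letter → Stack
    A  L = app L (blk v m V)
    A′ L = app L (ord (ord V))

    wf-A′ : ∀ L → WF (A′ L)
    wf-A′ L = WF-app L {V} (λ w → w) (wf-app L)
      where
      wf-app : ∀ L → WF (app L V)
      wf-app []        = proj₂ (proj₂ (proj₂ wf))
      wf-app (ord ∷ L) = wf-app L
      wf-app (dbl ∷ L) = wf-app L

    -- From the first letter after the block on, converting the block costs
    -- at most an eighth of the converted value.
    Ratio : List Letter → Set
    Ratio L = 8 * E₁ (A L) ≤ 9 * E₁ (A′ L) × 8 * E₀ (A L) ≤ 9 * E₀ (A′ L) × c + c ≤ E₁ (A′ L)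

    -- The constants come from the extreme case x = 2z, v = z with one ordinary letter, where the
    -- two values are 9z and 8z. Without any letter the bound on `E₀` can fail; further letters only
    -- add values already compared.
    ratio : ∀ a L → Ratio (a ∷ L)
    ratio ord [] = go x z v c x≤2z v≤z v+c≤2x
      where
      go : ∀ x z v c → x ≤ z + z → v ≤ z → v + c ≤ x + x →
        8 * (x + x + v + (x + x)) ≤ 9 * (x + z + x + (x + z)) ×
        8 * (x + x + v) ≤ 9 * (x + z + x) × c + c ≤ x + z + x + (x + z)
      go x z v c p q r =
        cert 0 0 (times 8 q ⊕ times 5 p) (solve (x ∷ z ∷ v ∷ [])) ,
        cert 0 (x + x + z) (times 8 q) (solve (x ∷ z ∷ v ∷ [])) ,
        cert 0 (v + v) (r ⊕ r ⊕ p) (solve (x ∷ z ∷ v ∷ c ∷ []))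
    ratio dbl [] = go x z v c v≤z v+c≤2x
      where
      go : ∀ x z v c → v ≤ z → v + c ≤ x + x →
        8 * (x + x + v + (x + x + v)) ≤ 9 * (x + z + x + (x + z + x)) ×
        8 * (x + x + v) ≤ 9 * (x + z + x) × c + c ≤ x + z + x + (x + z + x)
      go x z v c q r =
        cert 0 (4 * x + 2 * z) (times 16 q) (solve (x ∷ z ∷ v ∷ [])) ,
        cert 0 (x + x + z) (times 8 q) (solve (x ∷ z ∷ v ∷ [])) ,
        cert 0 (v + v + z + z) (r ⊕ r) (solve (x ∷ z ∷ v ∷ c ∷ []))
    ratio ord (a ∷ L) with ratio a L
    ... | p , q , r = add (E₁ (A (a ∷ L))) _ (E₁ (A′ (a ∷ L))) _ p q , p , ≤-trans r (m≤m+n _ _)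
      where
      add : ∀ a b a′ b′ → 8 * a ≤ 9 * a′ → 8 * b ≤ 9 * b′ → 8 * (a + b) ≤ 9 * (a′ + b′)
      add a b a′ b′ p q = cert 0 0 (p ⊕ q) (solve (a ∷ b ∷ a′ ∷ b′ ∷ []))
    ratio dbl (a ∷ L) with ratio a L
    ... | p , q , r = add (E₁ (A (a ∷ L))) (E₁ (A′ (a ∷ L))) p , p , ≤-trans r (m≤m+n _ _)
      where
      add : ∀ a a′ → 8 * a ≤ 9 * a′ → 8 * (a + a) ≤ 9 * (a′ + a′)
      add a a′ p = cert 0 0 (p ⊕ p) (solve (a ∷ a′ ∷ []))

    Gains : List Letter → Set
    Gains L = E₁ (A L) + c ≤ E₁ (A′ L) + E₀ (A′ L) ×
              E₁ (A L) + E₁ (A L) + c ≤ E₁ (A′ L) + E₀ (A′ L) + E₁ (A′ L)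

    -- With at most one letter after the block this is checked directly. From two letters on,
    -- `ratio` is applied to the whole word, and once more without the latest letter, which bounds
    -- `c` by half of `E₀`.
    gains : ∀ L → Gains L
    gains [] = go x z v c x≤2z v≤z v+c≤2x
      where
      go : ∀ x z v c → x ≤ z + z → v ≤ z → v + c ≤ x + x →
        x + x + v + c ≤ x + z + x + (x + z) ×
        x + x + v + (x + x + v) + c ≤ x + z + x + (x + z) + (x + z + x)
      go x z v c p q r =
        cert 0 0 (r ⊕ p) (solve (x ∷ z ∷ v ∷ c ∷ [])) ,
        cert 0 0 (r ⊕ q ⊕ p) (solve (x ∷ z ∷ v ∷ c ∷ []))
    gains (ord ∷ []) = go x z v c x≤2z v≤z v+c≤2x
      where
      go : ∀ x z v c → x ≤ z + z → v ≤ z → v + c ≤ x + x →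
        x + x + v + (x + x) + c ≤ x + z + x + (x + z) + (x + z + x) ×
        x + x + v + (x + x) + (x + x + v + (x + x)) + c ≤
        x + z + x + (x + z) + (x + z + x) + (x + z + x + (x + z))
      go x z v c p q r =
        cert 0 z (r ⊕ p) (solve (x ∷ z ∷ v ∷ c ∷ [])) ,
        cert 0 0 (r ⊕ q ⊕ p ⊕ p) (solve (x ∷ z ∷ v ∷ c ∷ []))
    gains (dbl ∷ []) = go x z v c v≤z v+c≤2x
      where
      go : ∀ x z v c → v ≤ z → v + c ≤ x + x →
        x + x + v + (x + x + v) + c ≤ x + z + x + (x + z + x) + (x + z + x) ×
        x + x + v + (x + x + v) + (x + x + v + (x + x + v)) + c ≤
        x + z + x + (x + z + x) + (x + z + x) + (x + z + x + (x + z + x))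
      go x z v c q r =
        cert 0 (z + z) (r ⊕ q) (solve (x ∷ z ∷ v ∷ c ∷ [])) ,
        cert 0 (z + z) (r ⊕ times 3 q) (solve (x ∷ z ∷ v ∷ c ∷ []))
    gains (a ∷ a′ ∷ L) =
      go (E₁ (A (a ∷ a′ ∷ L))) (E₁ (A′ (a ∷ a′ ∷ L))) (E₀ (A′ (a ∷ a′ ∷ L))) c
        (proj₁ (ratio a (a′ ∷ L))) (c≤ a) (proj₂ (E-bounds (A′ (a ∷ a′ ∷ L)) (wf-A′ (a ∷ a′ ∷ L))))
      where
      c≤ : ∀ a → c + c ≤ E₀ (A′ (a ∷ a′ ∷ L))
      c≤ ord = proj₂ (proj₂ (ratio a′ L))
      c≤ dbl = proj₂ (proj₂ (ratio a′ L))
      go : ∀ p q q₀ c → 8 * p ≤ 9 * q → c + c ≤ q₀ → q ≤ q₀ + q₀ →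
        p + c ≤ q + q₀ × p + p + c ≤ q + q₀ + q
      go p q q₀ c e f g =
        cert 7 (q₀ + q₀) (e ⊕ times 4 f ⊕ g) (solve (p ∷ q ∷ q₀ ∷ c ∷ [])) ,
        cert 7 0 (times 2 e ⊕ times 4 f ⊕ times 2 g) (solve (p ∷ q ∷ q₀ ∷ c ∷ []))

    popped : ∀ L → Popped (A L)
    popped L = record
      { W′     = ord (A′ L)
      ; len′   = cong suc (len-app L refl)
      ; wf′    = wf-A′ L
      ; open′  = open#-app L refl
      ; below′ = Below-app L {V = blk v m V} {W = ord (ord V)} proj₂
      ; γ      = hit I π (suc m)
      ; split  = λ i → trans (cong (λ f → f i) (β-app L (blk v m V)))
                   (cong (hit I π (suc m) i +_) (sym (cong (λ f → f i) (β-app L (ord (ord V))))))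
      ; gain₁  = proj₁ (gains L)
      ; gain₂  = proj₂ (gains L)
      ; tail   = tail
      }
      where
      Im : I m ≡ true
      Im = proj₁ (proj₁ (proj₂ wf))
      tail : ∀ c l → c + l ≡ N →
        sumFrom (β (ord (A′ L))) c l ≡ 0 ⊎ 1 ≤ sumFrom (hit I π (suc m)) c l
      -- This is why the last block is chosen: a tail that reaches down to `m` contains `m` from the
      -- freed fibre, and a later one misses the fibres of all earlier blocks.
      tail c l e with c ≤? m
      ... | yes c≤m = inj₂ (≤-trans (≤-reflexive (sym (hit-yes Im (proj₂ (proj₁ (proj₂ wf))))))
              (term≤sumFrom (hit I π (suc m)) m c l c≤m (subst (m <_) (sym e) (s≤s (I≤n Im)))))
      ... | no c≰m = inj₁ (sumFrom-0 c l (λ i c≤i →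
              trans (cong (λ f → f i) (β-app L (ord (ord V))))
                (β-above V (proj₁ (proj₂ (proj₂ wf))) i (≤-trans (<⇒≤ (≰⇒> c≰m)) c≤i))))

  pop : ∀ W → WF W → 1 ≤ open# W → Popped W
  pop W wf p with last-block W
  ... | inj₂ (L , v , m , V , refl) = PopBlock.popped v m V (WF-base L wf) L
  ... | inj₁ z with last-double W wf z p
  ...   | t , V , refl = PopDouble.popped V (WF-base (replicate t ord) {dbl V} wf) t z

  -- The invariant and its preservation at each kind of index.

  P Q : ℕ → ℕ
  P r = weight (cum I π r)
  Q r = weight (cum I ψ r)

  P-suc : ∀ r → P (suc r) ≡ P r + fibre (suc r)
  P-suc r = weight-+ (cum I π r) (hit I π (suc r))

  Q-suc : ∀ r → Q (suc r) ≡ Q r + weight (hit I ψ (suc r))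
  Q-suc r = weight-+ (cum I ψ r) (hit I ψ (suc r))

  -- P r ∸ Q r is the sum of the penalties still to be paid whose fine index is at most r.
  record Inv (r : ℕ) : Set where
    field
      W      : Stack
      wf     : WF W
      length : len W ≡ r
      opens  : open# W + total (cum I ψ (suc r)) ≡ total (cum I id (suc r))
      below  : Below (suc r) W
      -- Only tail counts are compared: a penalty may undo a block other than that of its own fibre,
      -- so the marks of `β W` and of the paid penalties can overlap.
      dom    : ∀ c l → c + l ≡ N →
        sumFrom (β W) c l + sumFrom (cum I ψ (suc r)) c l ≤ sumFrom (cum I π (suc r)) c l
      inv₁   : y (suc r) + P (suc r) ≤ E₁ W + weight (β W) + Q (suc r)
      inv₂   : y (suc r) + y r + P (suc r) ≤ E₁ W + E₀ W + weight (β W) + Q (suc r)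

    -- Since `h` is monotone, `dom` and Abel summation give `weight (β W) + Q (suc r) ≤ P (suc r)`,
    -- and these terms then drop out of `inv₁`.
    y≤E₁ : y (suc r) ≤ E₁ W
    y≤E₁ = go (y (suc r)) (P (suc r)) (E₁ W) (weight (β W)) (Q (suc r)) inv₁
      (≤-trans (≤-reflexive (sym (weight-+ (β W) (cum I ψ (suc r))))) (Abel.weighted-≤ N h-mono tails))
      where
      tails : ∀ c l → c + l ≡ N →
        sumFrom (λ i → β W i + cum I ψ (suc r) i) c l ≤ sumFrom (cum I π (suc r)) c l
      tails c l e = ≤-trans (≤-reflexive (sumFrom-+ (β W) (cum I ψ (suc r)) c l)) (dom c l e)
      go : ∀ a p e b q → a + p ≤ e + b + q → b + q ≤ p → a ≤ e
      go a p e b q f g = cert 0 0 (f ⊕ g) (solve (a ∷ p ∷ e ∷ b ∷ q ∷ []))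

  Misses : (ℕ → ℕ) → ℕ → Set
  Misses ρ r = ∀ i → I i ≡ true → ρ i ≢ r

  module _ (ρ : ℕ → ℕ) (r : ℕ) where

    sum-cum-suc : ∀ c l →
      sumFrom (cum I ρ (suc r)) c l ≡ sumFrom (cum I ρ r) c l + sumFrom (hit I ρ (suc r)) c l
    sum-cum-suc = sumFrom-+ (cum I ρ r) (hit I ρ (suc r))

    sum-cum-miss : Misses ρ (suc r) → ∀ c l → sumFrom (cum I ρ (suc r)) c l ≡ sumFrom (cum I ρ r) c l
    sum-cum-miss ne c l = sumFrom-cong c l
      (λ i → trans (cong (cum I ρ r i +_) (hit-no (ne i))) (+-identityʳ _))

    weight-cum-miss : Misses ρ (suc r) → weight (cum I ρ (suc r)) ≡ weight (cum I ρ r)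
    weight-cum-miss ne = weight-cong
      (λ i → trans (cong (cum I ρ r i +_) (hit-no (ne i))) (+-identityʳ _))

  I-false⇒Misses : ∀ {r} → I r ≡ false → Misses id r
  I-false⇒Misses ¬Ir i Ii refl with trans (sym Ii) ¬Ir
  ... | ()

  fibre-miss : ∀ {r} → Misses π r → fibre r ≡ 0
  fibre-miss ne = weight-0 (λ i → hit-no (ne i))

  module _ {r : ℕ} (S : Inv r) where
    open Inv S

    private
      k : ℕ
      k = suc (suc r)

    -- Serves ordinary indices, whose fibre is empty, and fines whose new debts fit into the step
    -- itself. The step consumes `inv₂`.
    push-ord : y k + fibre k ≤ y (suc r) + y r → I k ≡ false → Misses ψ k → Inv (suc r)
    push-ord yk ¬Ik ¬ψ = record
      { W      = ord W
      ; wf     = wf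
      ; length = cong suc length
      ; opens  = trans (cong (open# W +_) (sum-cum-miss ψ (suc r) ¬ψ 0 N))
                   (trans opens (sym (sum-cum-miss id (suc r) (I-false⇒Misses ¬Ik) 0 N)))
      ; below  = Below-mono (n≤1+n _) W below
      ; dom    = λ c l e → ≤-trans
          (≤-reflexive (cong (sumFrom (β W) c l +_) (sum-cum-miss ψ (suc r) ¬ψ c l)))
          (≤-trans (dom c l e) (≤-trans (m≤m+n _ _) (≤-reflexive (sym (sum-cum-suc π (suc r) c l)))))
      ; inv₁   = i₁
      ; inv₂   = second (y k) (y (suc r)) (P k) (E₁ W) (E₀ W) (weight (β W)) (Q k) i₁ y≤E₁
      }
      where
      first : ∀ yk y₁ y₀ C P e₁ e₀ B Q {P′ Q′} → P′ ≡ P + C → Q′ ≡ Q → yk + C ≤ y₁ + y₀ →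
        y₁ + y₀ + P ≤ e₁ + e₀ + B + Q → yk + P′ ≤ e₁ + e₀ + B + Q′
      first yk y₁ y₀ C P e₁ e₀ B Q refl refl f g =
        cert 0 0 (f ⊕ g) (solve (yk ∷ y₁ ∷ y₀ ∷ C ∷ P ∷ e₁ ∷ e₀ ∷ B ∷ Q ∷ []))
      second : ∀ yk y₁ P e₁ e₀ B Q → yk + P ≤ e₁ + e₀ + B + Q → y₁ ≤ e₁ →
        yk + y₁ + P ≤ e₁ + e₀ + e₁ + B + Q
      second yk y₁ P e₁ e₀ B Q f g =
        cert 0 0 (f ⊕ g) (solve (yk ∷ y₁ ∷ P ∷ e₁ ∷ e₀ ∷ B ∷ Q ∷ []))
      i₁ : y k + P k ≤ E₁ W + E₀ W + weight (β W) + Q k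
      i₁ = first (y k) (y (suc r)) (y r) (fibre k) (P (suc r)) (E₁ W) (E₀ W) (weight (β W)) (Q (suc r))
             (P-suc (suc r)) (weight-cum-miss ψ (suc r) ¬ψ) yk inv₂

    -- The debts in `inv₁` may be used only once, so the second copy of `y (suc r)` is bounded by
    -- `y≤E₁`.
    push-dbl : I k ≡ true → Misses ψ k → Misses π k → Inv (suc r)
    push-dbl Ik ¬ψ ¬π = record
      { W      = dbl W
      ; wf     = wf
      ; length = cong suc length
      ; opens  = trans (cong (λ t → suc (open# W) + t) (sum-cum-miss ψ (suc r) ¬ψ 0 N))
                   (trans (cong suc opens) (trans (+-comm 1 _)
                     (trans (cong (total (cum I id (suc r)) +_) (sym (total-hitid Ik)))
                       (sym (sum-cum-suc id (suc r) 0 N)))))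
      ; below  = Below-mono (n≤1+n _) W below
      ; dom    = λ c l e → subst₂ (λ a b → sumFrom (β W) c l + a ≤ b)
          (sym (sum-cum-miss ψ (suc r) ¬ψ c l)) (sym (sum-cum-miss π (suc r) ¬π c l)) (dom c l e)
      ; inv₁   = i₁
      ; inv₂   = second (y k) (y (suc r)) (P k) (E₁ W) (weight (β W)) (Q k) i₁ y≤E₁
      }
      where
      first : ∀ y₁ P e₁ B Q {yk P′ Q′} → yk ≡ y₁ + y₁ → P′ ≡ P → Q′ ≡ Q →
        y₁ + P ≤ e₁ + B + Q → y₁ ≤ e₁ → yk + P′ ≤ e₁ + e₁ + B + Q′
      first y₁ P e₁ B Q refl refl refl f g =
        cert 0 0 (f ⊕ g) (solve (y₁ ∷ P ∷ e₁ ∷ B ∷ Q ∷ []))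
      second : ∀ yk y₁ P e₁ B Q → yk + P ≤ e₁ + e₁ + B + Q → y₁ ≤ e₁ →
        yk + y₁ + P ≤ e₁ + e₁ + e₁ + B + Q
      second yk y₁ P e₁ B Q f g =
        cert 0 0 (f ⊕ g) (solve (yk ∷ y₁ ∷ P ∷ e₁ ∷ B ∷ Q ∷ []))
      i₁ : y k + P k ≤ E₁ W + E₁ W + weight (β W) + Q k
      i₁ = first (y (suc r)) (P (suc r)) (E₁ W) (weight (β W)) (Q (suc r))
             (double Ik) (weight-cum-miss π (suc r) ¬π) (weight-cum-miss ψ (suc r) ¬ψ) inv₁ y≤E₁

    -- The amount `h j` added at `k` also enters `Q` and cancels. What remains is that undoing a
    -- doubling lengthens the word by one step without loss.
    push-penalty : ∀ j → I j ≡ true → ψ j ≡ k → y k ≡ y (suc r) + h j →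
      I k ≡ false → Misses π k → Inv (suc r)
    push-penalty j Ij ψj yk ¬Ik ¬π = record
      { W      = W′
      ; wf     = wf′
      ; length = trans len′ (cong suc length)
      ; opens  = suc-injective (opens-pop (open# W) (open# W′) open′ opens ψ-count id-count)
      ; below  = Below-mono (n≤1+n _) W′ (below′ below)
      ; dom    = dom′
      ; inv₁   = first (y (suc r)) (h j) (P (suc r)) (E₁ W) (weight (β W)) (Q (suc r))
                   (E₁ W′) (weight γ) (weight (β W′)) yk Pk Qk β-split inv₁ gain₁
      ; inv₂   = second (y (suc r)) (h j) (P (suc r)) (E₁ W) (weight (β W)) (Q (suc r))
                   (E₁ W′) (E₀ W′) (weight γ) (weight (β W′)) yk Pk Qk β-split inv₁ y≤E₁ gain₂
      }
      where
      ψ-count : total (cum I ψ k) ≡ total (cum I ψ (suc r)) + 1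
      ψ-count = trans (sum-cum-suc ψ (suc r) 0 N)
        (cong (total (cum I ψ (suc r)) +_) (subst (λ q → total (hit I ψ q) ≡ 1) ψj (total-hitψ Ij)))
      id-count : total (cum I id k) ≡ total (cum I id (suc r))
      id-count = sum-cum-miss id (suc r) (I-false⇒Misses ¬Ik) 0 N
      -- Each `ψ i` exceeds `i`, so the penalties up to `k` number at most the exceptional indices
      -- up to `k`; as `k` is itself a penalty, some doubling was still open.
      1≤open : 1 ≤ open# W
      1≤open = go (open# W) (total (cum I ψ (suc r))) opens ψ-count id-count
        (sumFrom-mono 0 N (λ i → cum-antitone k i (λ Ii → <⇒≤ (<-trans (i<π Ii) (π<ψ Ii)))))
        where
        go : ∀ o t {t′ u u′} → o + t ≡ u → t′ ≡ t + 1 → u′ ≡ u → t′ ≤ u′ → 1 ≤ o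
        go o t refl refl refl f = cert 0 0 f (solve (o ∷ t ∷ []))
      open Popped (pop W wf 1≤open)
      opens-pop : ∀ o o′ {t t′ u u′} → o ≡ suc o′ → o + t ≡ u → t′ ≡ t + 1 → u′ ≡ u →
        suc (o′ + t′) ≡ suc u′
      opens-pop o o′ {t} refl refl refl refl = cong suc (solve (o′ ∷ t ∷ []))
      Pk : P k ≡ P (suc r)
      Pk = weight-cum-miss π (suc r) ¬π
      Qk : Q k ≡ Q (suc r) + h j
      Qk = trans (Q-suc (suc r))
        (cong (Q (suc r) +_) (subst (λ q → weight (hit I ψ q) ≡ h j) ψj (weight-hitψ Ij)))
      β-split : weight (β W) ≡ weight γ + weight (β W′)
      β-split = trans (weight-cong split) (weight-+ γ (β W′))
      first : ∀ y₁ x P e₁ B Q e₁′ g B′ {yk P′ Q′} → yk ≡ y₁ + x → P′ ≡ P → Q′ ≡ Q + x → B ≡ g + B′ →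
        y₁ + P ≤ e₁ + B + Q → e₁ + g ≤ e₁′ → yk + P′ ≤ e₁′ + B′ + Q′
      first y₁ x P e₁ B Q e₁′ g B′ refl refl refl refl f f′ =
        cert 0 0 (f ⊕ f′) (solve (y₁ ∷ x ∷ P ∷ e₁ ∷ Q ∷ e₁′ ∷ g ∷ B′ ∷ []))
      second : ∀ y₁ x P e₁ B Q e₁′ e₀′ g B′ {yk P′ Q′} → yk ≡ y₁ + x → P′ ≡ P → Q′ ≡ Q + x → B ≡ g + B′ →
        y₁ + P ≤ e₁ + B + Q → y₁ ≤ e₁ → e₁ + e₁ + g ≤ e₁′ + e₀′ → yk + y₁ + P′ ≤ e₁′ + e₀′ + B′ + Q′
      second y₁ x P e₁ B Q e₁′ e₀′ g B′ refl refl refl refl f f′ f″ =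
        cert 0 0 (f ⊕ f′ ⊕ f″) (solve (y₁ ∷ x ∷ P ∷ e₁ ∷ Q ∷ e₁′ ∷ e₀′ ∷ g ∷ B′ ∷ []))
      dom′ : ∀ c l → c + l ≡ N → sumFrom (β W′) c l + sumFrom (cum I ψ k) c l ≤ sumFrom (cum I π k) c l
      dom′ c l e with tail c l e
      ... | inj₁ z rewrite z = sumFrom-mono c l (λ i → cum-antitone k i (λ Ii → <⇒≤ (π<ψ Ii)))
      ... | inj₂ 1≤γ = go (sumFrom γ c l) (sumFrom (β W′) c l) (sumFrom (cum I ψ (suc r)) c l)
          (sumFrom (hit I ψ k) c l)
          (trans (sumFrom-cong c l split) (sumFrom-+ γ (β W′) c l))
          (sum-cum-suc ψ (suc r) c l) (sum-cum-miss π (suc r) ¬π c l) 1≤γ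
          (subst (λ q → sumFrom (hit I ψ q) c l ≤ 1) ψj (tail-hitψ Ij c l)) (dom c l e)
        where
        go : ∀ g b q x {s q′ p p′} → s ≡ g + b → q′ ≡ q + x → p′ ≡ p → 1 ≤ g → x ≤ 1 → s + q ≤ p →
          b + q′ ≤ p′
        go g b q x {p = p} refl refl refl f f′ f″ =
          cert 0 0 (f ⊕ f′ ⊕ f″) (solve (g ∷ b ∷ q ∷ x ∷ p ∷ []))

    -- Doubling and fine are appended together. The fibre of the fine contains `k`, so its penalties
    -- need not fit into an ordinary step; they enter `P` and `β` alike and cancel.
    push-blk : ∀ b → I k ≡ true → π k ≡ suc k → Misses ψ k → Misses π k →
      I (suc k) ≡ false → Misses ψ (suc k) →
      y (suc k) ≡ y k + b → b ≤ y r → b + fibre (suc k) ≤ y k → Inv (suc (suc r))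
    push-blk b Ik πk ¬ψ ¬π ¬Isk ¬ψ′ ysk b≤y₀ b+C≤ with amount
      where
      Amount : Set
      Amount = ∃[ v ] v ≤ b × v ≤ E₀ W ×
        y (suc r) + b + P (suc r) ≤ E₁ W + v + weight (β W) + Q (suc r)
      amount : Amount
      -- The block receives the smaller of `b` and `E₀ W`: in the first case `inv₁` suffices, in the
      -- second `b ≤ y r` reduces the claim to `inv₂`.
      amount with b ≤? E₀ W
      ... | yes p = b , ≤-refl , p , go (y (suc r)) b (P (suc r)) (E₁ W) (weight (β W)) (Q (suc r)) inv₁
        where
        go : ∀ y₁ b P e₁ B Q → y₁ + P ≤ e₁ + B + Q → y₁ + b + P ≤ e₁ + b + B + Q
        go y₁ b P e₁ B Q f = cert 0 0 f (solve (y₁ ∷ b ∷ P ∷ e₁ ∷ B ∷ Q ∷ []))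
      ... | no ¬p = E₀ W , <⇒≤ (≰⇒> ¬p) , ≤-refl ,
        ≤-trans (+-monoˡ-≤ (P (suc r)) (+-monoʳ-≤ (y (suc r)) b≤y₀)) inv₂
    ... | v , v≤b , v≤E₀ , key = record
      { W      = blk v k W
      ; wf     = (v≤E₀ , v+C≤) , (Ik , πk) , Below-mono (n≤1+n _) W below , wf
      ; length = cong (λ t → suc (suc t)) length
      ; opens  = trans (cong (λ t → suc (open# W) + t)
                   (trans (sum-cum-miss ψ k ¬ψ′ 0 N) (sum-cum-miss ψ (suc r) ¬ψ 0 N)))
                   (trans (cong suc opens) (trans (+-comm 1 _)
                     (trans (cong (total (cum I id (suc r)) +_) (sym (total-hitid Ik)))
                       (sym (trans (sum-cum-miss id k (I-false⇒Misses ¬Isk) 0 N)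
                         (sum-cum-suc id (suc r) 0 N))))))
      ; below  = ≤-refl , Below-mono (≤-trans (n≤1+n _) (n≤1+n _)) W below
      ; dom    = λ c l e → go (sumFrom (hit I π (suc k)) c l) (sumFrom (β W) c l)
          (sumFrom (cum I ψ (suc r)) c l) (sumFrom (cum I π (suc r)) c l)
          (sumFrom-+ (hit I π (suc k)) (β W) c l)
          (trans (sum-cum-miss ψ k ¬ψ′ c l) (sum-cum-miss ψ (suc r) ¬ψ c l))
          (trans (sum-cum-suc π k c l)
            (cong (_+ sumFrom (hit I π (suc k)) c l) (sum-cum-miss π (suc r) ¬π c l)))
          (dom c l e)
      ; inv₁   = i₁
      ; inv₂   = second (y (suc k)) (y k) (P (suc k)) (E₁ W) v (weight (β (blk v k W))) (Q (suc k))
                   i₁ yk≤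
      }
      where
      yk≤ : y k ≤ E₁ W + E₁ W
      yk≤ = ≤-trans (≤-reflexive (double Ik)) (y≤E₁ ⊕ y≤E₁)
      v+C≤ : v + fibre (suc k) ≤ E₁ W + E₁ W
      v+C≤ = ≤-trans (+-monoˡ-≤ _ v≤b) (≤-trans b+C≤ yk≤)
      go : ∀ f b q p {s q′ p′} → s ≡ f + b → q′ ≡ q → p′ ≡ p + f → b + q ≤ p → s + q′ ≤ p′
      go f b q p refl refl refl e = cert 0 0 e (solve (f ∷ b ∷ q ∷ p ∷ []))
      first : ∀ y₁ b C P e₁ v B Q {yk ysk P′ Q′ B′} → yk ≡ y₁ + y₁ → ysk ≡ yk + b → P′ ≡ P + C →
        Q′ ≡ Q → B′ ≡ C + B → y₁ + b + P ≤ e₁ + v + B + Q → y₁ ≤ e₁ → ysk + P′ ≤ e₁ + e₁ + v + B′ + Q′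
      first y₁ b C P e₁ v B Q refl refl refl refl refl f g =
        cert 0 0 (f ⊕ g) (solve (y₁ ∷ b ∷ C ∷ P ∷ e₁ ∷ v ∷ B ∷ Q ∷ []))
      second : ∀ ysk yk P e₁ v B Q → ysk + P ≤ e₁ + e₁ + v + B + Q → yk ≤ e₁ + e₁ →
        ysk + yk + P ≤ e₁ + e₁ + v + (e₁ + e₁) + B + Q
      second ysk yk P e₁ v B Q f g =
        cert 0 0 (f ⊕ g) (solve (ysk ∷ yk ∷ P ∷ e₁ ∷ v ∷ B ∷ Q ∷ []))
      i₁ : y (suc k) + P (suc k) ≤ E₁ W + E₁ W + v + weight (β (blk v k W)) + Q (suc k)
      i₁ = first (y (suc r)) b (fibre (suc k)) (P (suc r)) (E₁ W) v (weight (β W)) (Q (suc r))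
        (double Ik) ysk
        (trans (P-suc k) (cong (_+ fibre (suc k)) (weight-cum-miss π (suc r) ¬π)))
        (trans (weight-cum-miss ψ k ¬ψ′) (weight-cum-miss ψ (suc r) ¬ψ))
        (weight-+ (hit I π (suc k)) (β W)) key y≤E₁

  -- Running the comparison up to index `n`.

  init : Inv 0
  init = record
    -- The empty word already carries `y 1` and `y 0`, so `Inv r` speaks about the indices `suc r`
    -- and `r`.
    { W      = nil
    ; wf     = tt
    ; length = refl
    ; opens  = trans (sumFrom-0 0 N (λ i _ → noψ i)) (sym (sumFrom-0 0 N (λ i _ → cum-early 1 i I≥2)))
    ; below  = tt
    ; dom    = λ c l _ → ≤-trans (≤-reflexive (cong₂ _+_ (sumFrom-0 c l (λ _ _ → refl))
                 (sumFrom-0 c l (λ i _ → noψ i)))) z≤n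
    ; inv₁   = ≤-trans (≤-reflexive (cong₂ _+_ y1 P1)) (≤-trans (m≤m+n 2 (weight (β nil))) (m≤m+n (2 + weight (β nil)) (Q 1)))
    ; inv₂   = ≤-trans (≤-reflexive (cong₂ _+_ (cong₂ _+_ y1 y0) P1)) (≤-trans (m≤m+n 3 (weight (β nil))) (m≤m+n (3 + weight (β nil)) (Q 1)))
    }
    where
    1<π : ∀ {i} → I i ≡ true → 1 < π i
    1<π Ii = ≤-trans (I≥2 Ii) (<⇒≤ (i<π Ii))
    noψ : ∀ i → cum I ψ 1 i ≡ 0
    noψ i = cum-early 1 i (λ Ii → <-trans (1<π Ii) (π<ψ Ii))
    P1 : P 1 ≡ 0
    P1 = weight-0 (λ i → cum-early 1 i 1<π)

  exceptional-misses : ∀ r → suc (suc r) ≤ n → I (suc (suc r)) ≡ true →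
    Misses ψ (suc (suc r)) × Misses π (suc (suc r))
  exceptional-misses r le Ik with step r le
  ... | exceptional _ ¬ψ ¬π       = ¬ψ , ¬π
  ... | ordinary _ ¬Ik _ _        = ⊥-elim (I-false⇒Misses ¬Ik _ Ik refl)
  ... | penalty _ _ _ _ ¬Ik _     = ⊥-elim (I-false⇒Misses ¬Ik _ Ik refl)
  ... | fine _ _ _ _ _ ¬Ik _      = ⊥-elim (I-false⇒Misses ¬Ik _ Ik refl)

  module Fine {r : ℕ} (S : Inv r) (le : suc (suc r) ≤ n) {d : ℕ} (Id : I d ≡ true) (πd : π d ≡ suc (suc r))
    (d-least : ∀ i → I i ≡ true → π i ≡ suc (suc r) → d ≤ i)
    (yk : y (suc (suc r)) ≡ y (suc r) + y (d ∸ 2))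
    (¬Ik : I (suc (suc r)) ≡ false) (¬ψ : Misses ψ (suc (suc r))) where

    private
      k : ℕ
      k = suc (suc r)

    d<k : d < k
    d<k = subst (d <_) πd (i<π Id)

    y-d : y (d ∸ 2) ≤ y (d ∸ 1)
    y-d = y-mono-≤ (∸-monoʳ-≤ d (n≤1+n 1))

    below-d : ∀ i → i ≤ d ∸ 1 → hit I π k i ≡ 0
    below-d i i≤ = hit-no λ Ii πi →
      <⇒≱ (∸-monoʳ-< {d} (s≤s z≤n) (<⇒≤ (I≥2 Id))) (≤-trans (d-least i Ii πi) i≤)

    from-k : ∀ i → suc r < i → hit I π k i ≡ 0
    from-k i lt = hit-no (λ Ii πi → <⇒≱ (subst (i <_) πi (i<π Ii)) lt)

    -- With `k - 1` outside the fibre, the fibre lies between `d` and `r` and telescopes to at most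
    -- `y r` minus `y (d - 1)`; the amount `y (d - 2)` fits into the gap.
    detached : hit I π k (suc r) ≡ 0 → Inv (suc r)
    detached ¬hit = push-ord S
      (go (y (suc r)) (y (d ∸ 2)) (y (d ∸ 1)) (fibre k) (y r) yk y-d
        (fibre-bound k r (d ∸ 1) (≤-trans (m∸n≤m d 1) d≤r) below-d hi))
      ¬Ik ¬ψ
      where
      go : ∀ y₁ b a C y₀ {yk} → yk ≡ y₁ + b → b ≤ a → C + a ≤ y₀ → yk + C ≤ y₁ + y₀
      go y₁ b a C y₀ refl f g = cert 0 0 (f ⊕ g) (solve (y₁ ∷ b ∷ a ∷ C ∷ y₀ ∷ []))
      d≤r : d ≤ r
      d≤r with d ≟ suc r
      ... | no d≢ = ≤-pred (≤∧≢⇒< (≤-pred d<k) d≢)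
      ... | yes refl with trans (sym ¬hit) (hit-yes Id πd)
      ...   | ()
      hi : ∀ i → r < i → hit I π k i ≡ 0
      hi i r<i with i ≟ suc r
      ... | yes refl = ¬hit
      ... | no i≢ = from-k i (≤∧≢⇒< r<i (≢-sym i≢))

    -- With `k - 1` in the fibre, telescoping only reaches `y (k - 1)`, which is the bound a block
    -- asks for. The word is resumed from the state before the doubling at `k - 1`.
    attached : ∀ {r′} → suc r′ ≡ r → Inv r′ → I (suc r) ≡ true → π (suc r) ≡ k → Inv (suc r)
    attached {r′} refl S′ Im πm =
      push-blk S′ (y (d ∸ 2)) Im πm (proj₁ misses) (proj₂ misses) ¬Ik ¬ψ yk
        (y-mono-≤ (∸-monoˡ-≤ 2 d≤m))
        (≤-trans (≤-trans (+-monoˡ-≤ _ y-d) (≤-reflexive (+-comm (y (d ∸ 1)) _)))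
          (fibre-bound k (suc (suc r′)) (d ∸ 1) (≤-trans (m∸n≤m d 1) d≤m) below-d from-k))
      where
      misses : Misses ψ (suc (suc r′)) × Misses π (suc (suc r′))
      misses = exceptional-misses r′ (I≤n Im) Im
      d≤m : d ≤ suc (suc r′)
      d≤m = ≤-pred d<k

  -- The previous state is returned too, because a fine directly after a doubling in its fibre
  -- rebuilds the word from before that doubling.
  inv : ∀ r → suc r ≤ n → Inv r × (∀ {r′} → suc r′ ≡ r → Inv r′)
  inv zero    le = init , λ ()
  inv (suc r) le = next (step r le) , λ { refl → S }
    where
    previous : Inv r × (∀ {r′} → suc r′ ≡ r → Inv r′)
    previous = inv r (≤-trans (n≤1+n _) le)
    S : Inv r
    S = proj₁ previous
    next : Step I ψ π y (suc (suc r)) → Inv (suc r)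
    next (ordinary yk ¬Ik ¬ψ ¬π) =
      push-ord S (≤-reflexive (trans (cong₂ _+_ yk (fibre-miss ¬π)) (+-identityʳ _))) ¬Ik ¬ψ
    next (exceptional Ik ¬ψ ¬π) = push-dbl S Ik ¬ψ ¬π
    next (penalty j Ij ψj yk ¬Ik ¬π) = push-penalty S j Ij ψj yk ¬Ik ¬π
    next (fine d Id πd d-least yk ¬Ik ¬ψ) with hit-cases I π (suc (suc r)) (suc r)
    ... | inj₁ ¬hit = Fine.detached S le Id πd d-least yk ¬Ik ¬ψ ¬hit
    ... | inj₂ (_ , Im , πm) =
      Fine.attached S le Id πd d-least yk ¬Ik ¬ψ r≡ (proj₂ previous r≡) Im πm
      where
      -- The index `suc r` is exceptional, hence at least 2, so there is a previous state.
      r≡ : suc (r ∸ 1) ≡ r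
      r≡ = m+[n∸m]≡n (≤-pred (I≥2 Im))

  -- Without doublings every letter is an ordinary step, and the starting values 2 and 1 are `F 2`
  -- and `F 1`, whence the shift.
  closed-stack : ∀ W → open# W ≡ 0 → E₁ W ≡ F (suc (suc (len W))) × E₀ W ≡ F (suc (len W))
  closed-stack nil     e = refl , refl
  closed-stack (ord W) e with closed-stack W e
  ... | p , q = cong₂ _+_ p q , p

  bound : ∀ r → suc r ≡ n → y n ≤ F (suc n)
  bound r refl = ≤-trans y≤E₁
    (≤-reflexive (trans (proj₁ (closed-stack W all-closed)) (cong (λ t → F (suc (suc t))) length)))
    where
    open Inv (proj₁ (inv r ≤-refl))
    -- Every exceptional index and its penalty are at most `n`, so at the end both indicators are
    -- that of `I` and every doubling has been undone.
    same : ∀ i → cum I ψ n i ≡ cum I id n i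
    same i with I i in Ii
    ... | true  = trans (cum-late n i Ii (ψ≤n Ii)) (sym (cum-late n i Ii (I≤n Ii)))
    ... | false = trans (cum-early n i absurd) (sym (cum-early n i absurd))
      where
      absurd : ∀ {A : Set} → I i ≡ true → A
      absurd Ii′ = ⊥-elim (I-false⇒Misses Ii i Ii′ refl)
    all-closed : open# W ≡ 0
    all-closed = +-cancelʳ-≡ _ _ _ (trans opens (sym (sumFrom-cong 0 N same)))

-- From a system to the abstract recursion.

least-spec : ∀ p m →
  (∃[ l ] least p m ≡ just l × p l ≡ true × l < m × (∀ j → p j ≡ true → l ≤ j)) ⊎
  (least p m ≡ nothing × (∀ j → j < m → p j ≡ false))
least-spec p zero = inj₂ (refl , λ _ ())
least-spec p (suc m) with least p m | least-spec p m
... | .(just l) | inj₁ (l , refl , pl , l<m , l-least) = inj₁ (l , refl , pl , m<n⇒m<1+n l<m , l-least)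
... | .nothing  | inj₂ (refl , none) with p m in pm
...   | true  = inj₁ (m , refl , pm , ≤-refl , λ j pj → ≮⇒≥ (λ j<m → false≢true (trans (sym (none j j<m)) pj)))
  where
  false≢true : false ≢ true
  false≢true ()
...   | false = inj₂ (refl , none′)
  where
  none′ : ∀ j → j < suc m → p j ≡ false
  none′ j j<1+m with j ≟ m
  ... | yes refl = pm
  ... | no j≢m   = none j (≤∧≢⇒< (≤-pred j<1+m) j≢m)

-- The witness `i < m` rules out the default 0 of `fromMaybe`, so the searches behind `ψinv` and `d`
-- return genuine members of `I`.
least-in-fibre : ∀ {I : ℕ → Bool} {ρ : ℕ → ℕ} {m i} r → I i ≡ true → ρ i ≡ r → i < m →
  let l = fromMaybe 0 (least (λ i → I i ∧ (ρ i ≡ᵇ r)) m) in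
  I l ≡ true × ρ l ≡ r × (∀ j → I j ≡ true → ρ j ≡ r → l ≤ j)
least-in-fibre {I} {ρ} {m} {i} r Ii ρi i<m with least (λ i → I i ∧ (ρ i ≡ᵇ r)) m | least-spec (λ i → I i ∧ (ρ i ≡ᵇ r)) m
... | .(just l) | inj₁ (l , refl , pl , _ , l-least) =
  ∧-true₁ pl , ≡ᵇ-true⇒≡ (∧-true₂ pl) , λ j Ij ρj → l-least j (cong₂ _∧_ Ij (≡⇒≡ᵇ-true ρj))
  where
  ∧-true₁ : ∀ {a b} → a ∧ b ≡ true → a ≡ true
  ∧-true₁ {true} _ = refl
  ∧-true₂ : ∀ {a b} → a ∧ b ≡ true → b ≡ true
  ∧-true₂ {true} e = e
... | .nothing | inj₂ (refl , none) with trans (sym (none i i<m)) (cong₂ _∧_ Ii (≡⇒≡ᵇ-true ρi))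
...   | ()

module _ (S : System) (y : ℕ → ℕ) (gen : Generated S y) where
  open System S

  private
    rec : ∀ r → 2 ≤ r → r ≤ n → y r ≡ y (r ∸ 1) + y (θ S r)
    rec = proj₂ (proj₂ gen)

    true≢false : ∀ {b} {A : Set} → b ≡ true → b ≡ false → A
    true≢false refl ()

  -- `Generated` constrains `y` only up to `n`; freezing the sequence there makes it monotone on all
  -- of `ℕ`, as `Dynamics` demands.
  z : ℕ → ℕ
  z r = y (r ⊓ n)

  z≡y : ∀ {r} → r ≤ n → z r ≡ y r
  z≡y r≤n = cong y (m≤n⇒m⊓n≡m r≤n)

  1≤n : 1 ≤ n
  1≤n = <⇒≤ n≥2

  y-increasing : ∀ r → suc r ≤ n → y r ≤ y (suc r)
  y-increasing zero    _  = ≤-trans (≤-reflexive (proj₁ gen)) (≤-trans (n≤1+n 1) (≤-reflexive (sym (proj₁ (proj₂ gen)))))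
  y-increasing (suc r) le = ≤-trans (m≤m+n _ _) (≤-reflexive (sym (rec (suc (suc r)) (s≤s (s≤s z≤n)) le)))

  z-mono : ∀ r → z r ≤ z (suc r)
  z-mono r with suc r ≤? n
  ... | yes p = subst₂ _≤_ (sym (z≡y (<⇒≤ p))) (sym (z≡y p)) (y-increasing r p)
  ... | no ¬p = ≤-reflexive (cong y (trans (m≥n⇒m⊓n≡n n≤r) (sym (m≥n⇒m⊓n≡n (m≤n⇒m≤1+n n≤r)))))
    where
    n≤r : n ≤ r
    n≤r = ≤-pred (≰⇒> ¬p)

  θ-exceptional : ∀ {r} → I r ≡ true → θ S r ≡ r ∸ 1
  θ-exceptional e rewrite e = refl

  θ-penalty : ∀ {r} → I r ≡ false → J r ≡ true → θ S r ≡ ψinv S r ∸ 1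
  θ-penalty e f rewrite e | f = refl

  θ-fine : ∀ {r} → I r ≡ false → J r ≡ false → K r ≡ true → θ S r ≡ d S r ∸ 2
  θ-fine e f g rewrite e | f | g = refl

  θ-ordinary : ∀ {r} → I r ≡ false → J r ≡ false → K r ≡ false → θ S r ≡ r ∸ 2
  θ-ordinary e f g rewrite e | f | g = refl

  rec-z : ∀ {r t} → 2 ≤ r → r ≤ n → θ S r ≡ t → t ≤ n → z r ≡ z (r ∸ 1) + z t
  rec-z {r} {t} 2≤r r≤n refl t≤n = trans (z≡y r≤n) (trans (rec r 2≤r r≤n)
    (cong₂ _+_ (sym (z≡y (≤-trans (m∸n≤m r 1) r≤n))) (sym (z≡y t≤n))))

  I≤n : ∀ {i} → I i ≡ true → i ≤ n
  I≤n Ii = proj₂ (I⊆ _ Ii)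

  missesψ : ∀ {r} → J r ≡ false → ∀ i → I i ≡ true → ψ i ≢ r
  missesψ ¬Jr i Ii refl = true≢false (ψ-maps i Ii) ¬Jr

  missesπ : ∀ {r} → K r ≡ false → ∀ i → I i ≡ true → π i ≢ r
  missesπ ¬Kr i Ii refl = true≢false (π-maps i Ii) ¬Kr

  step : ∀ r → suc (suc r) ≤ n → Step I ψ π z (suc (suc r))
  step r le with I (suc (suc r)) in Ik
  ... | true = exceptional Ik (missesψ (IJ-disj _ Ik)) (missesπ (IK-disj _ Ik))
  ... | false with J (suc (suc r)) in Jk
  ...   | true with ψ-surj _ Jk
  ...     | i , Ii , ψi with least-in-fibre {I} {ψ} _ Ii ψi (s≤s (I≤n Ii))
  ...       | Il , ψl , _ = penalty (ψinv S (suc (suc r))) Il ψl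
                (rec-z (s≤s (s≤s z≤n)) le (θ-penalty Ik Jk) (≤-trans (m∸n≤m _ 1) (I≤n Il)))
                Ik (missesπ (JK-disj _ Jk))
  step r le | false | false with K (suc (suc r)) in Kk
  ...   | false = ordinary (rec-z (s≤s (s≤s z≤n)) le (θ-ordinary Ik Jk Kk) (≤-trans (m≤n+m r 2) le))
                    Ik (missesψ Jk) (missesπ Kk)
  ...   | true with π-surj _ Kk
  ...     | i , Ii , πi with least-in-fibre {I} {π} _ Ii πi (s≤s (I≤n Ii))
  ...       | Il , πl , l-least = fine (d S (suc (suc r))) Il πl l-least
                (rec-z (s≤s (s≤s z≤n)) le (θ-fine Ik Jk Kk) (≤-trans (m∸n≤m _ 2) (I≤n Il)))
                Ik (missesψ Jk)

  dynamics : Dynamics n I ψ π z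
  dynamics = record
    { y0     = trans (z≡y z≤n) (proj₁ gen)
    ; y1     = trans (z≡y 1≤n) (proj₁ (proj₂ gen))
    ; y-mono = z-mono
    ; I≥2    = λ Ii → proj₁ (I⊆ _ Ii)
    ; I≤n    = I≤n
    ; i<π    = π-ord _
    ; π<ψ    = ψ-ord _
    ; ψ≤n    = λ Ii → proj₂ (J⊆ _ (ψ-maps _ Ii))
    ; ψ-inj  = ψ-inj _ _
    ; double = λ Ii → rec-z (proj₁ (I⊆ _ Ii)) (I≤n Ii) (θ-exceptional Ii) (<⇒≤ (I≤n Ii))
    ; step   = step
    }

theorem4p15 : (S : System) (y : ℕ → ℕ) → Generated S y →
    y (System.n S) ≤ F (suc (System.n S))
theorem4p15 S y gen = subst (_≤ F (suc (System.n S))) (z≡y S y gen ≤-refl)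
  (Simulation.bound (dynamics S y gen) (System.n S ∸ 1) (m+[n∸m]≡n (1≤n S y gen)))
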